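{- Let $p$ be a prime, let $F_1\colon\mathbb{F}_p^n\to\mathbb{F}_p^m$ and $F_2\colon\mathbb{F}_p^k\to\mathbb{F}_p^m$ be two almost balanced bent functions, and let $F\colon\mathbb{F}_p^n\times\mathbb{F}_p^k\to\mathbb{F}_p^m$ be defined by $F(x,y)=F_1(x)+F_2(y)$. Then: 1. If $F_1$ and $F_2$ are both of type $(+)$, then $F$ is almost balanced of type $(+)$. 2. If $F_1$ and $F_2$ are both of type $(-)$, then $F$ is almost balanced of type $(+)$. 3. If $F_1$ is of type $(+)$ and $F_2$ is of type $(-)$, then $F$ is almost balanced of type $(-)$.
   Context: A function $F\colon\mathbb{F}_p^n\to\mathbb{F}_p^m$ is bent (perfect nonlinear) if $|\{x: F(x+a)-F(x)=b\}|=p^{n-m}$ for all nonzero $a\in\mathbb{F}_p^n$ and all $b\in\mathbb{F}_p^m$. A bent function $F\colon\mathbb{F}_p^n\to\mathbb{F}_p^m$ is almost balanced of type $(+)$ if for some $\alpha\in\mathbb{F}_p^m$, $|F^{ -1}(\alpha)|=p^{n-m}+p^{n/2}-p^{n/2-m}$ and $|F^{ -1}(\beta)|=p^{n-m}-p^{n/2-m}$ for all $\beta\neq\alpha$; it is almost balanced of type $(-)$ if for some $\alpha$, $|F^{ -1}(\alpha)|=p^{n-m}-p^{n/2}+p^{n/2-m}$ and $|F^{ -1}(\beta)|=p^{n-m}+p^{n/2-m}$ for all $\beta\neq\alpha$. It is almost balanced if it is of type $(+)$ or $(-)$. For the function $F$ on $\mathbb{F}_p^n\times\mathbb{F}_p^k\cong\mathbb{F}_p^{n+k}$,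 replace $n$ by $n+k$ in these definitions. -}

module Defs where

open import Data.Fin using (Fin; toℕ)
import Data.Fin.Properties as Fin
open import Data.Integer using (+_)
open import Data.List using (List; []; _∷_; allFin; cartesianProductWith; filter; length)
open import Data.Nat as ℕ using (ℕ; zero; suc; NonZero)
open import Data.Nat.DivMod using (_mod_)
import Data.Nat.Properties as ℕ
open import Data.Nat.Primality using (Prime; prime⇒nonZero)
open import Data.Product using (_×_; _,_; ∃-syntax)
open import Data.Rational as ℚ using (ℚ; 0ℚ; 1ℚ)
open import Data.Sum using (_⊎_)
open import Data.Vec using (Vec; []; _∷_; map; replicate; zipWith; take; drop)
open import Data.Vec.Properties using (≡-dec)
open import Relation.Binary using (DecidableEquality)
open import Relation.Binary.PropositionalEquality using (_≡_; _≢_)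

module Bentness {p : ℕ} (p-prime : Prime p) where

  private instance
    p≢0 : NonZero p
    p≢0 = prime⇒nonZero p-prime

  -- The additive group of the field with p elements: residues 0, …, p - 1.

  𝔽ₚ : Set
  𝔽ₚ = Fin p

  infixl 6 _+ₚ_
  _+ₚ_ : 𝔽ₚ → 𝔽ₚ → 𝔽ₚ
  x +ₚ y = (toℕ x ℕ.+ toℕ y) mod p

  -ₚ_ : 𝔽ₚ → 𝔽ₚ
  -ₚ x = (p ℕ.∸ toℕ x) mod p

  𝔽ₚ^ : ℕ → Set
  𝔽ₚ^ n = Vec 𝔽ₚ n

  0ᵥ : ∀ {n} → 𝔽ₚ^ n
  0ᵥ {n} = replicate n (0 mod p)

  infixl 6 _+ᵥ_ _-ᵥ_
  _+ᵥ_ : ∀ {n} → 𝔽ₚ^ n → 𝔽ₚ^ n → 𝔽ₚ^ n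
  _+ᵥ_ = zipWith _+ₚ_

  _-ᵥ_ : ∀ {n} → 𝔽ₚ^ n → 𝔽ₚ^ n → 𝔽ₚ^ n
  x -ᵥ y = x +ᵥ map -ₚ_ y

  infix 4 _≟ᵥ_
  _≟ᵥ_ : ∀ {n} → DecidableEquality (𝔽ₚ^ n)
  _≟ᵥ_ = ≡-dec Fin._≟_

  -- Every vector occurs exactly once in this list.
  allVectors : ∀ n → List (𝔽ₚ^ n)
  allVectors zero    = [] ∷ []
  allVectors (suc n) = cartesianProductWith _∷_ (allFin p) (allVectors n)

  ∣_⁻¹_∣ : ∀ {n m} → (𝔽ₚ^ n → 𝔽ₚ^ m) → 𝔽ₚ^ m → ℕ
  ∣_⁻¹_∣ {n} G β = length (filter (λ x → G x ≟ᵥ β) (allVectors n))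

  -- The real subfield ℚ(√p), the pair (a , b) standing for a + b√p with √p the
  -- positive root.  As p is prime, √p is irrational, so propositional equality
  -- of pairs is equality of real numbers.  It is the home of p^(n/2), where n
  -- is not assumed to be even.

  record ℚ√p : Set where
    constructor _+_√p
    field
      rational   : ℚ
      irrational : ℚ

  fromℚ : ℚ → ℚ√p
  fromℚ q = q + 0ℚ √p

  fromℕ : ℕ → ℚ√p
  fromℕ c = fromℚ (+ c ℚ./ 1)

  √p : ℚ√p
  √p = 0ℚ + 1ℚ √p

  infixl 6 _⊕_ _⊖_
  infixl 7 _⊗_

  _⊕_ : ℚ√p → ℚ√p → ℚ√p
  (a + b √p) ⊕ (c + d √p) = (a ℚ.+ c) + (b ℚ.+ d) √p

  _⊖_ : ℚ√p → ℚ√p → ℚ√p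
  (a + b √p) ⊖ (c + d √p) = (a ℚ.- c) + (b ℚ.- d) √p

  _⊗_ : ℚ√p → ℚ√p → ℚ√p
  (a + b √p) ⊗ (c + d √p) =
    (a ℚ.* c ℚ.+ (+ p ℚ./ 1) ℚ.* (b ℚ.* d)) + (a ℚ.* d ℚ.+ b ℚ.* c) √p

  -- p^[ n - m ] is p^(n - m); the exponent may be negative.
  p^[_-_] : ℕ → ℕ → ℚ√p
  p^[ n - m ] = fromℚ ((+ (p ℕ.^ n) ℚ./ (p ℕ.^ m)) {{ℕ.m^n≢0 p m}})

  -- p^[ n /2] is p^(n/2), as the n-th power of √p.
  p^[_/2] : ℕ → ℚ√p
  p^[ zero  /2] = fromℚ 1ℚ
  p^[ suc n /2] = √p ⊗ p^[ n /2]

  -- p^[ n /2- m ] is p^(n/2 - m).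
  p^[_/2-_] : ℕ → ℕ → ℚ√p
  p^[ n /2- m ] = p^[ n /2] ⊗ p^[ 0 - m ]

  Bent : ∀ {n m} → (𝔽ₚ^ n → 𝔽ₚ^ m) → Set
  Bent {n} {m} F =
    ∀ (a : 𝔽ₚ^ n) → a ≢ 0ᵥ → ∀ (b : 𝔽ₚ^ m) →
    fromℕ ∣ (λ x → F (x +ᵥ a) -ᵥ F x) ⁻¹ b ∣ ≡ p^[ n - m ]

  record AlmostBalanced⁺ {n m} (F : 𝔽ₚ^ n → 𝔽ₚ^ m) : Set where
    field
      bent   : Bent F
      fibres : ∃[ α ]
        fromℕ ∣ F ⁻¹ α ∣ ≡ p^[ n - m ] ⊕ p^[ n /2] ⊖ p^[ n /2- m ] ×
        (∀ β → β ≢ α → fromℕ ∣ F ⁻¹ β ∣ ≡ p^[ n - m ] ⊖ p^[ n /2- m ])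

  record AlmostBalanced⁻ {n m} (F : 𝔽ₚ^ n → 𝔽ₚ^ m) : Set where
    field
      bent   : Bent F
      fibres : ∃[ α ]
        fromℕ ∣ F ⁻¹ α ∣ ≡ p^[ n - m ] ⊖ p^[ n /2] ⊕ p^[ n /2- m ] ×
        (∀ β → β ≢ α → fromℕ ∣ F ⁻¹ β ∣ ≡ p^[ n - m ] ⊕ p^[ n /2- m ])

  AlmostBalanced : ∀ {n m} → (𝔽ₚ^ n → 𝔽ₚ^ m) → Set
  AlmostBalanced F = AlmostBalanced⁺ F ⊎ AlmostBalanced⁻ F

  directSum : ∀ {n k m} → (𝔽ₚ^ n → 𝔽ₚ^ m) → (𝔽ₚ^ k → 𝔽ₚ^ m) →
              𝔽ₚ^ n × 𝔽ₚ^ k → 𝔽ₚ^ m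
  directSum F₁ F₂ (x , y) = F₁ x +ᵥ F₂ y

  -- The identification of 𝔽ₚ^(n + k) with 𝔽ₚ^n × 𝔽ₚ^k.
  split : ∀ n {k} → 𝔽ₚ^ (n ℕ.+ k) → 𝔽ₚ^ n × 𝔽ₚ^ k
  split n z = take n z , drop n z

{-# OPTIONS --safe #-}

-- Write both types of almost balancedness as one formula with a sign ε:
--   |F⁻¹(β)| = p^(n-m) - ε p^(n/2-m) + [β = α] ε p^(n/2).
-- Summing over x the fibres {y : F₂(y) = γ - F₁(x)} turns the formula for F₂ into
--   |F⁻¹(γ)| = p^n (p^(k-m) - δ p^(k/2-m)) + |F₁⁻¹(γ - α₂)| δ p^(k/2),
-- and inserting the formula for F₁ gives that of F, with sign ε δ and α = α₁ + α₂.
-- For bentness, the derivative of F in direction (a₁ , a₂) is the direct sum of the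
-- derivatives of F₁ and F₂, one of which has all fibres of the same size.

module Submission where

open import Algebra using (CommutativeRing; CommutativeMonoid; AbelianGroup; IsCommutativeRing)
import Algebra.Properties.AbelianGroup as AbelianGroupProperties
import Algebra.Properties.CommutativeSemigroup as CommutativeSemigroupProperties
import Algebra.Properties.Ring as RingProperties
import Algebra.Solver.Ring as RingSolver
import Algebra.Solver.Ring.AlmostCommutativeRing as ACR
open import Data.Bool using (true; false; if_then_else_)
open import Data.Fin using (toℕ)
import Data.Fin.Properties as Fin
open import Data.Integer as ℤ using (+_)
import Data.Integer.Properties as ℤ
open import Data.List as List using (List; []; _∷_; allFin; cartesianProductWith; filter; length)
import Data.List.Properties as List
import Data.Maybe as Maybe
open import Data.Nat as ℕ using (ℕ; zero; suc; NonZero)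
open import Data.Nat.DivMod using (_%_; _mod_; m%n<n; %-distribˡ-+; m<n⇒m%n≡m; n%n≡0; m*n%n≡0)
import Data.Nat.Properties as ℕ
open import Data.Nat.Primality using (Prime; prime⇒nonZero)
open import Data.Product using (_×_; _,_; ∃-syntax)
open import Data.Rational as ℚ using (ℚ; 0ℚ; 1ℚ)
import Data.Rational.Properties as ℚ
open import Data.Rational.Solver using (module +-*-Solver)
open import Data.Rational.Unnormalised as ℚᵘ using (mkℚᵘ)
import Data.Rational.Unnormalised.Properties as ℚᵘ
open import Data.Vec as Vec using ([]; _∷_; replicate; take; drop; _++_)
import Data.Vec.Properties as Vec
open import Function using (_∘_; _⇔_; mk⇔; Equivalence)
open import Level using (0ℓ)
open import Relation.Binary.Consequences using (dec⇒weaklyDec)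
open import Relation.Binary.PropositionalEquality
open import Relation.Nullary using (Dec; yes; no; does; ¬_)
open import Relation.Nullary.Decidable using (does-⇔; dec-true; dec-false)
open import Defs

-- Arithmetic of fractions with explicit denominators

fromℚᵘ-homo-+ : ∀ a b → ℚ.fromℚᵘ (a ℚᵘ.+ b) ≡ ℚ.fromℚᵘ a ℚ.+ ℚ.fromℚᵘ b
fromℚᵘ-homo-+ a b = trans
  (ℚ.fromℚᵘ-cong (ℚᵘ.≃-sym (ℚᵘ.≃-trans (ℚ.toℚᵘ-homo-+ (ℚ.fromℚᵘ a) (ℚ.fromℚᵘ b))
    (ℚᵘ.+-cong (ℚ.toℚᵘ-fromℚᵘ a) (ℚ.toℚᵘ-fromℚᵘ b)))))
  (ℚ.fromℚᵘ-toℚᵘ _)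

fromℚᵘ-homo-* : ∀ a b → ℚ.fromℚᵘ (a ℚᵘ.* b) ≡ ℚ.fromℚᵘ a ℚ.* ℚ.fromℚᵘ b
fromℚᵘ-homo-* a b = trans
  (ℚ.fromℚᵘ-cong (ℚᵘ.≃-sym (ℚᵘ.≃-trans (ℚ.toℚᵘ-homo-* (ℚ.fromℚᵘ a) (ℚ.fromℚᵘ b))
    (ℚᵘ.*-cong (ℚ.toℚᵘ-fromℚᵘ a) (ℚ.toℚᵘ-fromℚᵘ b)))))
  (ℚ.fromℚᵘ-toℚᵘ _)

-- The unnormalised sum of `i/1` and `j/1` has numerator `i * 1 + j * 1`, hence the two identity
-- laws. The second argument of `mkℚᵘ` is the denominator minus one.
/1-homo-+ : ∀ i j → (i ℤ.+ j) ℚ./ 1 ≡ i ℚ./ 1 ℚ.+ j ℚ./ 1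
/1-homo-+ i j = trans
  (cong (ℚ._/ 1) (sym (cong₂ ℤ._+_ (ℤ.*-identityʳ i) (ℤ.*-identityʳ j))))
  (fromℚᵘ-homo-+ (mkℚᵘ i 0) (mkℚᵘ j 0))

-- The unnormalised product has denominator `1 * suc d`, which computes to `suc d + 0`; only this
-- has to be corrected.
/-homo-* : ∀ i j d .{{_ : NonZero d}} →
           (i ℤ.* j) ℚ./ d ≡ i ℚ./ 1 ℚ.* (j ℚ./ d)
/-homo-* i j (suc d) = trans
  (ℚ./-cong {i ℤ.* j} refl (sym (ℕ.+-identityʳ (suc d))))
  (fromℚᵘ-homo-* (mkℚᵘ i 0) (mkℚᵘ j d))

length-cartesianProductWith :
  ∀ {A B C : Set} (f : A → B → C) xs ys →
  length (cartesianProductWith f xs ys) ≡ length xs ℕ.* length ys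
length-cartesianProductWith f []       ys = refl
length-cartesianProductWith f (x ∷ xs) ys = trans
  (List.length-++ (List.map (f x) ys))
  (cong₂ ℕ._+_ (List.length-map (f x) ys) (length-cartesianProductWith f xs ys))

replicate-++ : ∀ {A : Set} m n (a : A) → replicate m a ++ replicate n a ≡ replicate (m ℕ.+ n) a
replicate-++ zero    n a = refl
replicate-++ (suc m) n a = cong (a ∷_) (replicate-++ m n a)

-- The ring is abstract because the operations of ℚ(√p) unfold to pairs, which
-- makes unification against them slow.
module RingSums
  {C : Set} {_⊕_ _⊗_ : C → C → C} {⊝_ : C → C} {0# 1# : C}
  (isCommutativeRing : IsCommutativeRing _≡_ _⊕_ _⊗_ ⊝_ 0# 1#)
  (ι : ℕ → C) (ι-zero : ι 0 ≡ 0#) (ι-suc : ∀ n → ι (suc n) ≡ 1# ⊕ ι n)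
  where

  private
    commutativeRing : CommutativeRing 0ℓ 0ℓ
    commutativeRing = record { isCommutativeRing = isCommutativeRing }

  open CommutativeRing commutativeRing
    using (_+_; _*_; -_; _-_; +-identityˡ; +-identityʳ; +-assoc; zeroˡ; zeroʳ; distribʳ;
           *-identityˡ; ring; +-commutativeMonoid)
  open RingProperties ring using (-1*x≈-x; -‿involutive)
  open CommutativeSemigroupProperties
    (CommutativeMonoid.commutativeSemigroup +-commutativeMonoid) using (interchange; xy∙z≈xz∙y)

  -- Finite sums and indicators in a commutative ring

  Σ : ∀ {A : Set} → List A → (A → C) → C
  Σ []       f = 0#
  Σ (x ∷ xs) f = f x + Σ xs f

  -- The Iverson bracket. It reads only the Boolean `does`, so it can be transported along an
  -- equivalence of propositions.
  𝟙 : ∀ {A : Set} → Dec A → C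
  𝟙 a? = if does a? then 1# else 0#

  module _ {A : Set} where

    Σ-cong : ∀ (xs : List A) {f g} → (∀ x → f x ≡ g x) → Σ xs f ≡ Σ xs g
    Σ-cong []       f≡g = refl
    Σ-cong (x ∷ xs) f≡g = cong₂ _+_ (f≡g x) (Σ-cong xs f≡g)

    Σ-const : ∀ (xs : List A) c → Σ xs (λ _ → c) ≡ ι (length xs) * c
    Σ-const []       c = sym (trans (cong (_* c) ι-zero) (zeroˡ c))
    Σ-const (x ∷ xs) c = begin
      c + Σ xs (λ _ → c)            ≡⟨ cong₂ _+_ (sym (*-identityˡ c)) (Σ-const xs c) ⟩
      1# * c + ι (length xs) * c    ≡⟨ distribʳ c 1# (ι (length xs)) ⟨
      (1# + ι (length xs)) * c      ≡⟨ cong (_* c) (ι-suc (length xs)) ⟨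
      ι (suc (length xs)) * c       ∎
      where open ≡-Reasoning

    Σ-homo-+ : ∀ (xs : List A) f g → Σ xs (λ x → f x + g x) ≡ Σ xs f + Σ xs g
    Σ-homo-+ []       f g = sym (+-identityˡ 0#)
    Σ-homo-+ (x ∷ xs) f g = trans (cong₂ _+_ refl (Σ-homo-+ xs f g))
      (interchange (f x) (g x) (Σ xs f) (Σ xs g))

    Σ-homo-* : ∀ (xs : List A) f c → Σ xs (λ x → f x * c) ≡ Σ xs f * c
    Σ-homo-* []       f c = sym (zeroˡ c)
    Σ-homo-* (x ∷ xs) f c = trans (cong₂ _+_ refl (Σ-homo-* xs f c))
      (sym (distribʳ c (f x) (Σ xs f)))

    Σ-++ : ∀ (xs ys : List A) f → Σ (xs List.++ ys) f ≡ Σ xs f + Σ ys f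
    Σ-++ []       ys f = sym (+-identityˡ _)
    Σ-++ (x ∷ xs) ys f = trans (cong₂ _+_ refl (Σ-++ xs ys f))
      (sym (+-assoc (f x) (Σ xs f) (Σ ys f)))

    -- The bridge from cardinalities to sums: `filter` branches on the same Boolean as `𝟙`.
    Σ-filter : ∀ {P : A → Set} (P? : ∀ x → Dec (P x)) xs →
               ι (length (filter P? xs)) ≡ Σ xs (𝟙 ∘ P?)
    Σ-filter P? []       = ι-zero
    Σ-filter P? (x ∷ xs) with does (P? x)
    ... | true  = trans (ι-suc _) (cong₂ _+_ refl (Σ-filter P? xs))
    ... | false = trans (Σ-filter P? xs) (sym (+-identityˡ _))

  module _ {A B : Set} where

    Σ-map : ∀ (g : A → B) xs f → Σ (List.map g xs) f ≡ Σ xs (f ∘ g)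
    Σ-map g []       f = refl
    Σ-map g (x ∷ xs) f = cong₂ _+_ refl (Σ-map g xs f)

    Σ-swap : ∀ (xs : List A) (ys : List B) (f : A → B → C) →
             Σ xs (λ x → Σ ys (f x)) ≡ Σ ys (λ y → Σ xs (λ x → f x y))
    Σ-swap []       ys f = sym (trans (Σ-const ys 0#) (zeroʳ _))
    Σ-swap (x ∷ xs) ys f = trans (cong₂ _+_ refl (Σ-swap xs ys f)) (sym (Σ-homo-+ ys (f x) _))

  Σ-cartesianProductWith :
    ∀ {A B D : Set} (g : A → B → D) xs ys f →
    Σ (cartesianProductWith g xs ys) f ≡ Σ xs (λ x → Σ ys (f ∘ g x))
  Σ-cartesianProductWith g []       ys f = refl
  Σ-cartesianProductWith g (x ∷ xs) ys f = trans
    (Σ-++ (List.map (g x) ys) _ f)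
    (cong₂ _+_ (Σ-map (g x) ys f) (Σ-cartesianProductWith g xs ys f))

  𝟙-cong : ∀ {A B : Set} → A ⇔ B → (a? : Dec A) (b? : Dec B) → 𝟙 a? ≡ 𝟙 b?
  𝟙-cong A⇔B a? b? = cong (if_then 1# else 0#) (does-⇔ A⇔B a? b?)

  𝟙-yes : ∀ {A : Set} (a? : Dec A) → A → 𝟙 a? ≡ 1#
  𝟙-yes a? a = cong (if_then 1# else 0#) (dec-true a? a)

  𝟙-no : ∀ {A : Set} (a? : Dec A) → ¬ A → 𝟙 a? ≡ 0#
  𝟙-no a? ¬a = cong (if_then 1# else 0#) (dec-false a? ¬a)

  -- The sign rule by which two functions of type (-) give one of type (+).
  -1*-1≡1 : - 1# * - 1# ≡ 1#
  -1*-1≡1 = trans (-1*x≈-x (- 1#)) (-‿involutive 1#)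

  -- Fibre sizes of types (+) and (-), with x = p^(n-m), y = p^(n/2), z = p^(n/2-m).

  ⁺-at : ∀ x y z → x - 1# * z + 1# * (1# * y) ≡ x + y - z
  ⁺-at x y z = trans
    (cong₂ (λ z y → x - z + y) (*-identityˡ z) (trans (*-identityˡ _) (*-identityˡ y)))
    (xy∙z≈xz∙y x (- z) y)

  ⁺-off : ∀ x y z → x - 1# * z + 0# * (1# * y) ≡ x - z
  ⁺-off x y z = trans
    (cong₂ (λ z y → x - z + y) (*-identityˡ z) (zeroˡ (1# * y)))
    (+-identityʳ (x - z))

  ⁻-at : ∀ x y z → x - - 1# * z + 1# * (- 1# * y) ≡ x - y + z
  ⁻-at x y z = trans
    (cong₂ (λ z y → x + z + y)
      (trans (cong -_ (-1*x≈-x z)) (-‿involutive z))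
      (trans (*-identityˡ _) (-1*x≈-x y)))
    (xy∙z≈xz∙y x z (- y))

  ⁻-off : ∀ x y z → x - - 1# * z + 0# * (- 1# * y) ≡ x + z
  ⁻-off x y z = trans
    (cong₂ (λ z y → x + z + y)
      (trans (cong -_ (-1*x≈-x z)) (-‿involutive z))
      (zeroˡ (- 1# * y)))
    (+-identityʳ (x + z))

module DirectSum {p : ℕ} (p-prime : Prime p) where

  open Bentness p-prime

  private instance
    p≢0 : NonZero p
    p≢0 = prime⇒nonZero p-prime

  -- The additive group of 𝔽ₚ^ n

  mod-cong : ∀ {a b} → a % p ≡ b % p → a mod p ≡ b mod p
  mod-cong {a} {b} eq = Fin.toℕ-injective (begin
    toℕ (a mod p) ≡⟨ Fin.toℕ-fromℕ< (m%n<n a p) ⟩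
    a % p         ≡⟨ eq ⟩
    b % p         ≡⟨ Fin.toℕ-fromℕ< (m%n<n b p) ⟨
    toℕ (b mod p) ∎)
    where open ≡-Reasoning

  toℕ-mod : ∀ x → toℕ x mod p ≡ x
  toℕ-mod x = Fin.toℕ-injective
    (trans (Fin.toℕ-fromℕ< (m%n<n (toℕ x) p)) (m<n⇒m%n≡m (Fin.toℕ<n x)))

  -- With `toℕ-mod`, this reduces the associativity, identity and inverse laws of `_+ₚ_` to
  -- computations in ℕ.
  mod-homo-+ : ∀ a b → (a ℕ.+ b) mod p ≡ a mod p +ₚ b mod p
  mod-homo-+ a b = mod-cong (begin
    (a ℕ.+ b) % p                         ≡⟨ %-distribˡ-+ a b p ⟩
    (a % p ℕ.+ b % p) % p
      ≡⟨ cong₂ (λ u v → (u ℕ.+ v) % p) (Fin.toℕ-fromℕ< (m%n<n a p)) (Fin.toℕ-fromℕ< (m%n<n b p)) ⟨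
    (toℕ (a mod p) ℕ.+ toℕ (b mod p)) % p ∎)
    where open ≡-Reasoning

  +ₚ-comm : ∀ x y → x +ₚ y ≡ y +ₚ x
  +ₚ-comm x y = cong (_mod p) (ℕ.+-comm (toℕ x) (toℕ y))

  +ₚ-assoc : ∀ x y z → (x +ₚ y) +ₚ z ≡ x +ₚ (y +ₚ z)
  +ₚ-assoc x y z = begin
    (x +ₚ y) +ₚ z                         ≡⟨ cong ((x +ₚ y) +ₚ_) (toℕ-mod z) ⟨
    (x +ₚ y) +ₚ toℕ z mod p               ≡⟨ mod-homo-+ (toℕ x ℕ.+ toℕ y) (toℕ z) ⟨
    (toℕ x ℕ.+ toℕ y ℕ.+ toℕ z) mod p     ≡⟨ cong (_mod p) (ℕ.+-assoc (toℕ x) (toℕ y) (toℕ z)) ⟩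
    (toℕ x ℕ.+ (toℕ y ℕ.+ toℕ z)) mod p   ≡⟨ mod-homo-+ (toℕ x) (toℕ y ℕ.+ toℕ z) ⟩
    toℕ x mod p +ₚ (y +ₚ z)               ≡⟨ cong (_+ₚ (y +ₚ z)) (toℕ-mod x) ⟩
    x +ₚ (y +ₚ z)                         ∎
    where open ≡-Reasoning

  +ₚ-identityˡ : ∀ x → 0 mod p +ₚ x ≡ x
  +ₚ-identityˡ x = begin
    0 mod p +ₚ x           ≡⟨ cong (0 mod p +ₚ_) (toℕ-mod x) ⟨
    0 mod p +ₚ toℕ x mod p ≡⟨ mod-homo-+ 0 (toℕ x) ⟨
    toℕ x mod p            ≡⟨ toℕ-mod x ⟩
    x                      ∎
    where open ≡-Reasoning

  -ₚ-inverseʳ : ∀ x → x +ₚ -ₚ x ≡ 0 mod p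
  -ₚ-inverseʳ x = begin
    x +ₚ -ₚ x                        ≡⟨ cong (_+ₚ -ₚ x) (toℕ-mod x) ⟨
    toℕ x mod p +ₚ -ₚ x              ≡⟨ mod-homo-+ (toℕ x) (p ℕ.∸ toℕ x) ⟨
    -- Truncated subtraction is exact here because `toℕ x < p`.
    (toℕ x ℕ.+ (p ℕ.∸ toℕ x)) mod p  ≡⟨ cong (_mod p) (ℕ.m+[n∸m]≡n (ℕ.<⇒≤ (Fin.toℕ<n x))) ⟩
    p mod p                          ≡⟨ mod-cong (trans (n%n≡0 p) (sym (m*n%n≡0 0 p))) ⟩
    0 mod p                          ∎
    where open ≡-Reasoning

  +ᵥ-abelianGroup : ℕ → AbelianGroup 0ℓ 0ℓ
  +ᵥ-abelianGroup n = record
    { Carrier = 𝔽ₚ^ n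
    ; _≈_     = _≡_
    ; _∙_     = _+ᵥ_
    ; ε       = 0ᵥ
    ; _⁻¹     = Vec.map -ₚ_
    ; isAbelianGroup = record
      { isGroup = record
        { isMonoid = record
          { isSemigroup = record
            { isMagma = record { isEquivalence = isEquivalence ; ∙-cong = cong₂ _+ᵥ_ }
            ; assoc   = Vec.zipWith-assoc +ₚ-assoc
            }
          ; identity = Vec.zipWith-identityˡ +ₚ-identityˡ
                     , Vec.zipWith-identityʳ (λ x → trans (+ₚ-comm x _) (+ₚ-identityˡ x))
          }
        ; inverse = Vec.zipWith-inverseˡ (λ x → trans (+ₚ-comm (-ₚ x) x) (-ₚ-inverseʳ x))
                  , Vec.zipWith-inverseʳ -ₚ-inverseʳ
        ; ⁻¹-cong = cong (Vec.map -ₚ_)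
        }
      ; comm = Vec.zipWith-comm +ₚ-comm
      }
    }

  module _ {n : ℕ} where

    open AbelianGroup (+ᵥ-abelianGroup n)
      using (comm; commutativeSemigroup)
    open AbelianGroupProperties (+ᵥ-abelianGroup n)
      using (x≈z//y; //-rightDividesˡ; ⁻¹-∙-comm)
    open CommutativeSemigroupProperties commutativeSemigroup using (interchange)

    +ᵥ≡⇔≡-ᵥ : ∀ (x y z : 𝔽ₚ^ n) → x +ᵥ y ≡ z ⇔ x ≡ z -ᵥ y
    +ᵥ≡⇔≡-ᵥ x y z = mk⇔ (x≈z//y x y z)
      (λ eq → trans (cong (_+ᵥ y) eq) (//-rightDividesˡ y z))

    +ᵥ≡⇔≡-ᵥ′ : ∀ (x y z : 𝔽ₚ^ n) → x +ᵥ y ≡ z ⇔ y ≡ z -ᵥ x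
    +ᵥ≡⇔≡-ᵥ′ x y z = mk⇔ (E.to ∘ trans (comm y x)) (trans (comm x y) ∘ E.from)
      where module E = Equivalence (+ᵥ≡⇔≡-ᵥ y x z)

    -- Both sides are equivalent to `x +ᵥ y ≡ z`. This turns a condition on the fibre of `F₂` over
    -- `γ -ᵥ F₁ x` into one on `F₁ x`.
    -ᵥ≡⇔≡-ᵥ : ∀ (x y z : 𝔽ₚ^ n) → z -ᵥ x ≡ y ⇔ x ≡ z -ᵥ y
    -ᵥ≡⇔≡-ᵥ x y z = mk⇔ (Eˡ.to ∘ Eʳ.from ∘ sym) (sym ∘ Eʳ.to ∘ Eˡ.from)
      where
      module Eˡ = Equivalence (+ᵥ≡⇔≡-ᵥ x y z)
      module Eʳ = Equivalence (+ᵥ≡⇔≡-ᵥ′ x y z)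

    -ᵥ-interchange : ∀ (a b c d : 𝔽ₚ^ n) → (a +ᵥ b) -ᵥ (c +ᵥ d) ≡ (a -ᵥ c) +ᵥ (b -ᵥ d)
    -ᵥ-interchange a b c d = trans
      (cong ((a +ᵥ b) +ᵥ_) (sym (⁻¹-∙-comm c d)))
      (interchange a b _ _)

  -- The ring ℚ(√p)

  0√ 1√ : ℚ√p
  0√ = fromℚ 0ℚ
  1√ = fromℚ 1ℚ

  infix 8 ⊝_
  ⊝_ : ℚ√p → ℚ√p
  ⊝ (a + b √p) = (ℚ.- a) + (ℚ.- b) √p

  ⊕-⊗-commutativeRing : CommutativeRing 0ℓ 0ℓ
  ⊕-⊗-commutativeRing = record
    { Carrier = ℚ√p
    ; _≈_     = _≡_
    ; _+_     = _⊕_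
    ; _*_     = _⊗_
    ; -_      = ⊝_
    ; 0#      = 0√
    ; 1#      = 1√
    ; isCommutativeRing = record
      { isRing = record
        { +-isAbelianGroup = record
          { isGroup = record
            { isMonoid = record
              { isSemigroup = record
                { isMagma = record { isEquivalence = isEquivalence ; ∙-cong = cong₂ _⊕_ }
                ; assoc   = λ (a + b √p) (c + d √p) (e + f √p) →
                    cong₂ _+_√p (ℚ.+-assoc a c e) (ℚ.+-assoc b d f)
                }
              ; identity =
                  (λ (a + b √p) → cong₂ _+_√p (ℚ.+-identityˡ a) (ℚ.+-identityˡ b))
                , (λ (a + b √p) → cong₂ _+_√p (ℚ.+-identityʳ a) (ℚ.+-identityʳ b))
              }
            ; inverse =
                (λ (a + b √p) → cong₂ _+_√p (ℚ.+-inverseˡ a) (ℚ.+-inverseˡ b))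
              , (λ (a + b √p) → cong₂ _+_√p (ℚ.+-inverseʳ a) (ℚ.+-inverseʳ b))
            ; ⁻¹-cong = cong ⊝_
            }
          ; comm = ⊕-comm
          }
        ; *-cong     = cong₂ _⊗_
        ; *-assoc    = ⊗-assoc
        ; *-identity = ⊗-identityˡ , λ x → trans (⊗-comm x 1√) (⊗-identityˡ x)
        ; distrib    = ⊗-distribˡ-⊕
                     , λ x y z → trans (⊗-comm (y ⊕ z) x)
                         (trans (⊗-distribˡ-⊕ x y z) (cong₂ _⊕_ (⊗-comm x y) (⊗-comm x z)))
        }
      ; *-comm = ⊗-comm
      }
    }
    where
    open +-*-Solver

    -- The solver treats `P` as an indeterminate: the ring laws are polynomial identities in the
    -- coordinates, valid for every rational `P`.
    P : ℚ
    P = + p ℚ./ 1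

    ⊕-comm : ∀ x y → x ⊕ y ≡ y ⊕ x
    ⊕-comm (a + b √p) (c + d √p) = cong₂ _+_√p (ℚ.+-comm a c) (ℚ.+-comm b d)

    ⊗-comm : ∀ x y → x ⊗ y ≡ y ⊗ x
    ⊗-comm (a + b √p) (c + d √p) = cong₂ _+_√p
      (solve 5 (λ P a b c d → a :* c :+ P :* (b :* d) := c :* a :+ P :* (d :* b)) refl P a b c d)
      (solve 4 (λ a b c d → a :* d :+ b :* c := c :* b :+ d :* a) refl a b c d)

    ⊗-assoc : ∀ x y z → (x ⊗ y) ⊗ z ≡ x ⊗ (y ⊗ z)
    ⊗-assoc (a + b √p) (c + d √p) (e + f √p) = cong₂ _+_√p
      (solve 7 (λ P a b c d e f →
          (a :* c :+ P :* (b :* d)) :* e :+ P :* ((a :* d :+ b :* c) :* f)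
        := a :* (c :* e :+ P :* (d :* f)) :+ P :* (b :* (c :* f :+ d :* e)))
        refl P a b c d e f)
      (solve 7 (λ P a b c d e f →
          (a :* c :+ P :* (b :* d)) :* f :+ (a :* d :+ b :* c) :* e
        := a :* (c :* f :+ d :* e) :+ b :* (c :* e :+ P :* (d :* f)))
        refl P a b c d e f)

    ⊗-identityˡ : ∀ x → 1√ ⊗ x ≡ x
    ⊗-identityˡ (a + b √p) = cong₂ _+_√p
      (solve 3 (λ P a b → con 1ℚ :* a :+ P :* (con 0ℚ :* b) := a) refl P a b)
      (solve 2 (λ a b → con 1ℚ :* b :+ con 0ℚ :* a := b) refl a b)

    ⊗-distribˡ-⊕ : ∀ x y z → x ⊗ (y ⊕ z) ≡ x ⊗ y ⊕ x ⊗ z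
    ⊗-distribˡ-⊕ (a + b √p) (c + d √p) (e + f √p) = cong₂ _+_√p
      (solve 7 (λ P a b c d e f →
          a :* (c :+ e) :+ P :* (b :* (d :+ f))
        := (a :* c :+ P :* (b :* d)) :+ (a :* e :+ P :* (b :* f)))
        refl P a b c d e f)
      (solve 6 (λ a b c d e f →
          a :* (d :+ f) :+ b :* (c :+ e) := (a :* d :+ b :* c) :+ (a :* f :+ b :* e))
        refl a b c d e f)

  fromℚ-homo-⊗ : ∀ a b → fromℚ (a ℚ.* b) ≡ fromℚ a ⊗ fromℚ b
  fromℚ-homo-⊗ a b = cong₂ _+_√p
    (solve 3 (λ P a b → a :* b := a :* b :+ P :* (con 0ℚ :* con 0ℚ)) refl (+ p ℚ./ 1) a b)
    (solve 2 (λ a b → con 0ℚ := a :* con 0ℚ :+ con 0ℚ :* b) refl a b)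
    where open +-*-Solver

  fromℚ-morphism :
    CommutativeRing.rawRing ℚ.+-*-commutativeRing ACR.-Raw-AlmostCommutative⟶
    ACR.fromCommutativeRing ⊕-⊗-commutativeRing
  fromℚ-morphism = record
    { ⟦_⟧    = fromℚ
    -- The irrational coordinates `0 + 0` and `- 0` are closed and compute; only the product leaves
    -- open terms.
    ; +-homo = λ _ _ → refl
    ; *-homo = fromℚ-homo-⊗
    ; -‿homo = λ _ → refl
    ; 0-homo = refl
    ; 1-homo = refl
    }

  -- With rational coefficients the solver decides whether a coefficient
  -- vanishes; in ℚ(√p) that test would be stuck on the variable p.
  open RingSolver _ _ fromℚ-morphism
    (λ a b → Maybe.map (cong fromℚ) (dec⇒weaklyDec ℚ._≟_ a b))
    using (solve; _:=_; _:+_; _:-_; _:*_)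

  open CommutativeRing ⊕-⊗-commutativeRing using (+-identityʳ; *-identityˡ)

  -- Powers of p and of √p

  fromℕ-homo-+ : ∀ a b → fromℕ (a ℕ.+ b) ≡ fromℕ a ⊕ fromℕ b
  fromℕ-homo-+ a b = cong fromℚ (/1-homo-+ (+ a) (+ b))

  -- Only the numerator changes, over the fixed denominator `p^m`. This evaluates a sum of `p^n`
  -- equal fibre sizes.
  p^-shift : ∀ n k m → fromℕ (p ℕ.^ n) ⊗ p^[ k - m ] ≡ p^[ n ℕ.+ k - m ]
  p^-shift n k m = begin
    fromℕ (p ℕ.^ n) ⊗ p^[ k - m ]
      ≡⟨ fromℚ-homo-⊗ (+ (p ℕ.^ n) ℚ./ 1) (+ (p ℕ.^ k) ℚ./ p ℕ.^ m) ⟨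
    fromℚ ((+ (p ℕ.^ n) ℚ./ 1) ℚ.* (+ (p ℕ.^ k) ℚ./ p ℕ.^ m))
      ≡⟨ cong fromℚ (/-homo-* (+ (p ℕ.^ n)) (+ (p ℕ.^ k)) (p ℕ.^ m)) ⟨
    fromℚ ((+ (p ℕ.^ n) ℤ.* + (p ℕ.^ k)) ℚ./ p ℕ.^ m)
      ≡⟨ cong (λ i → fromℚ (i ℚ./ p ℕ.^ m)) (ℤ.pos-* (p ℕ.^ n) (p ℕ.^ k)) ⟨
    fromℚ (+ (p ℕ.^ n ℕ.* p ℕ.^ k) ℚ./ p ℕ.^ m)
      ≡⟨ cong (λ a → fromℚ (+ a ℚ./ p ℕ.^ m)) (ℕ.^-distribˡ-+-* p n k) ⟨
    p^[ n ℕ.+ k - m ] ∎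
    where
    open ≡-Reasoning
    instance
      p^m≢0 : NonZero (p ℕ.^ m)
      p^m≢0 = ℕ.m^n≢0 p m

  -- Isolates `p^(-m)` as a common factor of the terms in which `m` occurs.
  p^-factor : ∀ n m → p^[ n - m ] ≡ fromℕ (p ℕ.^ n) ⊗ p^[ 0 - m ]
  p^-factor n m = trans (cong p^[_- m ] (sym (ℕ.+-identityʳ n))) (sym (p^-shift n 0 m))

  √p⊗√p : √p ⊗ √p ≡ fromℕ p
  √p⊗√p = cong₂ _+_√p
    -- The rational coordinate contains the variable `p`, so it needs the solver; the irrational one
    -- is closed.
    (+-*-Solver.solve 1 (λ P → S.con 0ℚ S.:* S.con 0ℚ S.:+ P S.:* (S.con 1ℚ S.:* S.con 1ℚ) S.:= P) refl _)
    refl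
    where module S = +-*-Solver

  p^½-homo-+ : ∀ n k → p^[ n ℕ.+ k /2] ≡ p^[ n /2] ⊗ p^[ k /2]
  p^½-homo-+ zero    k = sym (*-identityˡ p^[ k /2])
  p^½-homo-+ (suc n) k = trans (cong (√p ⊗_) (p^½-homo-+ n k))
    (solve 3 (λ r a b → r :* (a :* b) := r :* a :* b) refl √p p^[ n /2] p^[ k /2])

  -- Each new factor `p` splits as `√p ⊗ √p`. This ties the number of vectors to the half powers in
  -- the fibre sizes.
  p^½-square : ∀ n → fromℕ (p ℕ.^ n) ≡ p^[ n /2] ⊗ p^[ n /2]
  p^½-square zero    = sym (*-identityˡ 1√)
  p^½-square (suc n) = begin
    fromℕ (p ℕ.* p ℕ.^ n)                  ≡⟨ cong fromℚ (cong (ℚ._/ 1) (ℤ.pos-* p (p ℕ.^ n))) ⟩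
    fromℚ ((+ p ℤ.* + (p ℕ.^ n)) ℚ./ 1)    ≡⟨ cong fromℚ (/-homo-* (+ p) (+ (p ℕ.^ n)) 1) ⟩
    fromℚ ((+ p ℚ./ 1) ℚ.* (+ (p ℕ.^ n) ℚ./ 1)) ≡⟨ fromℚ-homo-⊗ (+ p ℚ./ 1) (+ (p ℕ.^ n) ℚ./ 1) ⟩
    fromℕ p ⊗ fromℕ (p ℕ.^ n)              ≡⟨ cong₂ _⊗_ (sym √p⊗√p) (p^½-square n) ⟩
    √p ⊗ √p ⊗ (p^[ n /2] ⊗ p^[ n /2])
      ≡⟨ solve 2 (λ r a → r :* r :* (a :* a) := r :* a :* (r :* a)) refl √p p^[ n /2] ⟩
    √p ⊗ p^[ n /2] ⊗ (√p ⊗ p^[ n /2])      ∎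
    where open ≡-Reasoning

  -- Counting as summation in ℚ(√p)

  open RingSums (CommutativeRing.isCommutativeRing ⊕-⊗-commutativeRing)
    -- `suc n` is `1 + n` by definition, so additivity gives the successor law.
    fromℕ refl (fromℕ-homo-+ 1) public

  length-allVectors : ∀ n → length (allVectors n) ≡ p ℕ.^ n
  length-allVectors zero    = refl
  length-allVectors (suc n) = trans
    (length-cartesianProductWith _∷_ (allFin p) (allVectors n))
    (cong₂ ℕ._*_ (List.length-tabulate {n = p} (λ i → i)) (length-allVectors n))

  Σ-allVectors-const : ∀ n c → Σ (allVectors n) (λ _ → c) ≡ fromℕ (p ℕ.^ n) ⊗ c
  Σ-allVectors-const n c = trans (Σ-const (allVectors n) c)
    (cong (λ l → fromℕ l ⊗ c) (length-allVectors n))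

  -- Induction on `n`: both sides begin with the same sum over the first coordinate `a`, and fixing
  -- it leaves the claim for `f ∘ (a ∷_)`.
  Σ-split : ∀ n {k} (f : 𝔽ₚ^ n → 𝔽ₚ^ k → ℚ√p) →
            Σ (allVectors (n ℕ.+ k)) (λ z → f (take n z) (drop n z)) ≡
            Σ (allVectors n) (λ x → Σ (allVectors k) (f x))
  Σ-split zero    f = sym (+-identityʳ (Σ (allVectors _) (f [])))
  Σ-split (suc n) f = trans
    (Σ-cartesianProductWith _∷_ (allFin p) (allVectors (n ℕ.+ _)) _)
    (trans
      (Σ-cong (allFin p) (λ a → Σ-split n (f ∘ (a ∷_))))
      (sym (Σ-cartesianProductWith _∷_ (allFin p) (allVectors n) _)))

  Σ-fibre : ∀ {n m} (G : 𝔽ₚ^ n → 𝔽ₚ^ m) β →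
            fromℕ ∣ G ⁻¹ β ∣ ≡ Σ (allVectors n) (λ x → 𝟙 (G x ≟ᵥ β))
  Σ-fibre G β = Σ-filter (λ x → G x ≟ᵥ β) (allVectors _)

  fibre-cong : ∀ {n m} {G H : 𝔽ₚ^ n → 𝔽ₚ^ m} {β γ} →
               (∀ x → G x ≡ β ⇔ H x ≡ γ) → fromℕ ∣ G ⁻¹ β ∣ ≡ fromℕ ∣ H ⁻¹ γ ∣
  fibre-cong {G = G} {H} {β} {γ} G⇔H = trans (Σ-fibre G β) (trans
    (Σ-cong (allVectors _) (λ x → 𝟙-cong (G⇔H x) (G x ≟ᵥ β) (H x ≟ᵥ γ)))
    (sym (Σ-fibre H γ)))

  module _ {n k m} (F₁ : 𝔽ₚ^ n → 𝔽ₚ^ m) (F₂ : 𝔽ₚ^ k → 𝔽ₚ^ m) (γ : 𝔽ₚ^ m) where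

    -- For fixed `x`, the equation `F₁ x +ᵥ F₂ y ≡ γ` is solved for `F₂ y`. Applied below to the
    -- functions themselves and to their derivatives.
    directSum-fibre : fromℕ ∣ directSum F₁ F₂ ∘ split n ⁻¹ γ ∣ ≡
                      Σ (allVectors n) (λ x → fromℕ ∣ F₂ ⁻¹ (γ -ᵥ F₁ x) ∣)
    directSum-fibre = begin
      fromℕ ∣ directSum F₁ F₂ ∘ split n ⁻¹ γ ∣
        ≡⟨ Σ-fibre (directSum F₁ F₂ ∘ split n) γ ⟩
      Σ (allVectors (n ℕ.+ k)) (λ z → 𝟙 (directSum F₁ F₂ (split n z) ≟ᵥ γ))
        ≡⟨ Σ-split n (λ x y → 𝟙 (directSum F₁ F₂ (x , y) ≟ᵥ γ)) ⟩
      Σ (allVectors n) (λ x → Σ (allVectors k) (λ y → 𝟙 (F₁ x +ᵥ F₂ y ≟ᵥ γ)))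
        ≡⟨ Σ-cong (allVectors n) (λ x → Σ-fibre (λ y → F₁ x +ᵥ F₂ y) γ) ⟨
      Σ (allVectors n) (λ x → fromℕ ∣ (λ y → F₁ x +ᵥ F₂ y) ⁻¹ γ ∣)
        ≡⟨ Σ-cong (allVectors n) (λ x → fibre-cong (λ y → +ᵥ≡⇔≡-ᵥ′ (F₁ x) (F₂ y) γ)) ⟩
      Σ (allVectors n) (λ x → fromℕ ∣ F₂ ⁻¹ (γ -ᵥ F₁ x) ∣) ∎
      where open ≡-Reasoning

    -- The sums are exchanged and the equation is solved for `F₁ x`; this serves the case where the
    -- derivative of `F₁` is the one known to have equal fibres.
    directSum-fibre′ : fromℕ ∣ directSum F₁ F₂ ∘ split n ⁻¹ γ ∣ ≡
                       Σ (allVectors k) (λ y → fromℕ ∣ F₁ ⁻¹ (γ -ᵥ F₂ y) ∣)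
    directSum-fibre′ = begin
      fromℕ ∣ directSum F₁ F₂ ∘ split n ⁻¹ γ ∣
        ≡⟨ Σ-fibre (directSum F₁ F₂ ∘ split n) γ ⟩
      Σ (allVectors (n ℕ.+ k)) (λ z → 𝟙 (directSum F₁ F₂ (split n z) ≟ᵥ γ))
        ≡⟨ Σ-split n (λ x y → 𝟙 (directSum F₁ F₂ (x , y) ≟ᵥ γ)) ⟩
      Σ (allVectors n) (λ x → Σ (allVectors k) (λ y → 𝟙 (F₁ x +ᵥ F₂ y ≟ᵥ γ)))
        ≡⟨ Σ-swap (allVectors n) (allVectors k) _ ⟩
      Σ (allVectors k) (λ y → Σ (allVectors n) (λ x → 𝟙 (F₁ x +ᵥ F₂ y ≟ᵥ γ)))
        ≡⟨ Σ-cong (allVectors k) (λ y → Σ-fibre (λ x → F₁ x +ᵥ F₂ y) γ) ⟨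
      Σ (allVectors k) (λ y → fromℕ ∣ (λ x → F₁ x +ᵥ F₂ y) ⁻¹ γ ∣)
        ≡⟨ Σ-cong (allVectors k) (λ y → fibre-cong (λ x → +ᵥ≡⇔≡-ᵥ (F₁ x) (F₂ y) γ)) ⟩
      Σ (allVectors k) (λ y → fromℕ ∣ F₁ ⁻¹ (γ -ᵥ F₂ y) ∣) ∎
      where open ≡-Reasoning

  -- Bentness and fibres of a direct sum

  derivative : ∀ {n m} → (𝔽ₚ^ n → 𝔽ₚ^ m) → 𝔽ₚ^ n → 𝔽ₚ^ n → 𝔽ₚ^ m
  derivative F a x = F (x +ᵥ a) -ᵥ F x

  -- A vector is the concatenation of its two parts, and zero vectors concatenate to a zero vector.
  split≢0 : ∀ n {k} (a : 𝔽ₚ^ (n ℕ.+ k)) → a ≢ 0ᵥ → take n a ≡ 0ᵥ → drop n a ≢ 0ᵥ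
  split≢0 n a a≢0 take≡0 drop≡0 = a≢0 (trans (sym (Vec.take++drop≡id n a))
    (trans (cong₂ _++_ take≡0 drop≡0) (replicate-++ n _ _)))

  -- `take` and `drop` commute with addition, and the four values are then regrouped by
  -- `-ᵥ-interchange`.
  directSum-derivative :
    ∀ {n k m} (F₁ : 𝔽ₚ^ n → 𝔽ₚ^ m) (F₂ : 𝔽ₚ^ k → 𝔽ₚ^ m) a z →
    derivative (directSum F₁ F₂ ∘ split n) a z ≡
    directSum (derivative F₁ (take n a)) (derivative F₂ (drop n a)) (split n z)
  directSum-derivative {n} F₁ F₂ a z = trans
    (cong₂ (λ u v → (F₁ u +ᵥ F₂ v) -ᵥ directSum F₁ F₂ (split n z))
      (Vec.take-zipWith _+ₚ_ z a) (Vec.drop-zipWith {m = n} _+ₚ_ z a))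
    (-ᵥ-interchange _ _ _ _)

  directSum-bent : ∀ {n k m} (F₁ : 𝔽ₚ^ n → 𝔽ₚ^ m) (F₂ : 𝔽ₚ^ k → 𝔽ₚ^ m) →
                   Bent F₁ → Bent F₂ → Bent (directSum F₁ F₂ ∘ split n)
  directSum-bent {n} {k} {m} F₁ F₂ bent₁ bent₂ a a≢0 b = trans
    -- The derivative is known to be a direct sum only pointwise, which suffices to compare fibres.
    (fibre-cong (λ z → mk⇔ (trans (sym (D≡ z))) (trans (D≡ z))))
    (count (take n a ≟ᵥ 0ᵥ))
    where
    open ≡-Reasoning
    D₁ = derivative F₁ (take n a)
    D₂ = derivative F₂ (drop n a)

    D≡ : ∀ z → derivative (directSum F₁ F₂ ∘ split n) a z ≡ directSum D₁ D₂ (split n z)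
    D≡ = directSum-derivative F₁ F₂ a

    count : Dec (take n a ≡ 0ᵥ) → fromℕ ∣ directSum D₁ D₂ ∘ split n ⁻¹ b ∣ ≡ p^[ n ℕ.+ k - m ]
    -- The second component of `a` is nonzero, so all fibres of `D₂` have the same size.
    count (yes take≡0) = begin
      fromℕ ∣ directSum D₁ D₂ ∘ split n ⁻¹ b ∣           ≡⟨ directSum-fibre D₁ D₂ b ⟩
      Σ (allVectors n) (λ x → fromℕ ∣ D₂ ⁻¹ (b -ᵥ D₁ x) ∣)
        ≡⟨ Σ-cong (allVectors n) (λ x → bent₂ (drop n a) (split≢0 n a a≢0 take≡0) _) ⟩
      Σ (allVectors n) (λ x → p^[ k - m ])               ≡⟨ Σ-allVectors-const n _ ⟩
      fromℕ (p ℕ.^ n) ⊗ p^[ k - m ]                      ≡⟨ p^-shift n k m ⟩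
      p^[ n ℕ.+ k - m ]                                  ∎
    -- The fibres of `D₁` have the same size, so the sum runs over the second variable instead.
    count (no take≢0) = begin
      fromℕ ∣ directSum D₁ D₂ ∘ split n ⁻¹ b ∣           ≡⟨ directSum-fibre′ D₁ D₂ b ⟩
      Σ (allVectors k) (λ y → fromℕ ∣ D₁ ⁻¹ (b -ᵥ D₂ y) ∣)
        ≡⟨ Σ-cong (allVectors k) (λ y → bent₁ (take n a) take≢0 _) ⟩
      Σ (allVectors k) (λ y → p^[ n - m ])               ≡⟨ Σ-allVectors-const k _ ⟩
      fromℕ (p ℕ.^ k) ⊗ p^[ n - m ]                      ≡⟨ p^-shift k n m ⟩
      p^[ k ℕ.+ n - m ]                                  ≡⟨ cong p^[_- m ] (ℕ.+-comm k n) ⟩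
      p^[ n ℕ.+ k - m ]                                  ∎

  -- The case β = α is i = 1, the case β ≠ α is i = 0; types (+) and (-) are
  -- ε = 1 and ε = -1.
  fibreSize : ℕ → ℕ → ℚ√p → ℚ√p → ℚ√p
  fibreSize n m ε i = p^[ n - m ] ⊖ ε ⊗ p^[ n /2- m ] ⊕ i ⊗ (ε ⊗ p^[ n /2])

  -- A record, so that ε, F and α can be inferred from it.
  record HasFibres {n m} (ε : ℚ√p) (F : 𝔽ₚ^ n → 𝔽ₚ^ m) (α : 𝔽ₚ^ m) : Set where
    field
      size : ∀ β → fromℕ ∣ F ⁻¹ β ∣ ≡ fibreSize n m ε (𝟙 (β ≟ᵥ α))

  open HasFibres

  -- Here `h`, `g`, `H` are the half powers for `n`, `k`, `n + k`, and `q` is `p^(-m)`. Taking the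
  -- other powers as variables with equations lets `refl` eliminate them and leaves a polynomial
  -- identity, in which the two terms `δ h h g q` cancel.
  directSum-identity : ∀ h g q i ε δ {N X₁ X₂ X H} →
    N ≡ h ⊗ h → X₁ ≡ h ⊗ h ⊗ q → X₂ ≡ g ⊗ g ⊗ q → X ≡ H ⊗ H ⊗ q → H ≡ h ⊗ g →
    N ⊗ (X₂ ⊖ δ ⊗ (g ⊗ q)) ⊕ (X₁ ⊖ ε ⊗ (h ⊗ q) ⊕ i ⊗ (ε ⊗ h)) ⊗ (δ ⊗ g) ≡
    X ⊖ ε ⊗ δ ⊗ (H ⊗ q) ⊕ i ⊗ (ε ⊗ δ ⊗ H)
  directSum-identity h g q i ε δ refl refl refl refl refl =
    solve 6 (λ h g q i ε δ →
        h :* h :* (g :* g :* q :- δ :* (g :* q)) :+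
          (h :* h :* q :- ε :* (h :* q) :+ i :* (ε :* h)) :* (δ :* g)
      := h :* g :* (h :* g) :* q :- ε :* δ :* (h :* g :* q) :+ i :* (ε :* δ :* (h :* g)))
      refl h g q i ε δ

  -- The signs multiply. The product is named `ζ` so that it can be given directly as `1√` or
  -- `⊝ 1√`.
  directSum-hasFibres :
    ∀ {n k m} {F₁ : 𝔽ₚ^ n → 𝔽ₚ^ m} {F₂ : 𝔽ₚ^ k → 𝔽ₚ^ m} {ε δ ζ α₁ α₂} →
    ε ⊗ δ ≡ ζ → HasFibres ε F₁ α₁ → HasFibres δ F₂ α₂ →
    HasFibres ζ (directSum F₁ F₂ ∘ split n) (α₁ +ᵥ α₂)
  directSum-hasFibres {n} {k} {m} {F₁} {F₂} {ε} {δ} {_} {α₁} {α₂} refl fibres₁ fibres₂ .size γ = begin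
    fromℕ ∣ directSum F₁ F₂ ∘ split n ⁻¹ γ ∣
      ≡⟨ directSum-fibre F₁ F₂ γ ⟩
    Σ (allVectors n) (λ x → fromℕ ∣ F₂ ⁻¹ (γ -ᵥ F₁ x) ∣)
      -- The indicator becomes a condition on `F₁ x`, so that its sum over `x` is the size of a
      -- fibre of `F₁`.
      ≡⟨ Σ-cong (allVectors n) (λ x → trans (fibres₂ .size (γ -ᵥ F₁ x))
           (cong (fibreSize k m δ)
             (𝟙-cong (-ᵥ≡⇔≡-ᵥ (F₁ x) α₂ γ) (γ -ᵥ F₁ x ≟ᵥ α₂) (F₁ x ≟ᵥ γ -ᵥ α₂)))) ⟩
    Σ (allVectors n) (λ x → A ⊕ 𝟙 (F₁ x ≟ᵥ γ -ᵥ α₂) ⊗ D)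
      ≡⟨ Σ-homo-+ (allVectors n) (λ _ → A) (λ x → 𝟙 (F₁ x ≟ᵥ γ -ᵥ α₂) ⊗ D) ⟩
    Σ (allVectors n) (λ _ → A) ⊕ Σ (allVectors n) (λ x → 𝟙 (F₁ x ≟ᵥ γ -ᵥ α₂) ⊗ D)
      ≡⟨ cong₂ _⊕_ (Σ-allVectors-const n A)
           (trans (Σ-homo-* (allVectors n) (λ x → 𝟙 (F₁ x ≟ᵥ γ -ᵥ α₂)) D)
             (cong (_⊗ D) (sym (Σ-fibre F₁ (γ -ᵥ α₂))))) ⟩
    fromℕ (p ℕ.^ n) ⊗ A ⊕ fromℕ ∣ F₁ ⁻¹ (γ -ᵥ α₂) ∣ ⊗ D
      ≡⟨ cong (λ c → fromℕ (p ℕ.^ n) ⊗ A ⊕ c ⊗ D) (trans (fibres₁ .size (γ -ᵥ α₂))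
           (cong (fibreSize n m ε)
             (𝟙-cong γ-α₂≡α₁⇔γ≡α₁+α₂ (γ -ᵥ α₂ ≟ᵥ α₁) (γ ≟ᵥ α₁ +ᵥ α₂)))) ⟩
    fromℕ (p ℕ.^ n) ⊗ A ⊕ fibreSize n m ε i ⊗ D
      ≡⟨ directSum-identity p^[ n /2] p^[ k /2] q i ε δ
           (p^½-square n) (p^-factor-square n) (p^-factor-square k)
           (p^-factor-square (n ℕ.+ k)) (p^½-homo-+ n k) ⟩
    fibreSize (n ℕ.+ k) m (ε ⊗ δ) i ∎
    where
    open ≡-Reasoning
    -- `A` is the size of the fibres of `F₂` away from `α₂`, and `D` the signed excess of the fibre
    -- over `α₂`.
    A = p^[ k - m ] ⊖ δ ⊗ p^[ k /2- m ]
    D = δ ⊗ p^[ k /2]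

    γ-α₂≡α₁⇔γ≡α₁+α₂ : γ -ᵥ α₂ ≡ α₁ ⇔ γ ≡ α₁ +ᵥ α₂
    γ-α₂≡α₁⇔γ≡α₁+α₂ = mk⇔ (sym ∘ E.from ∘ sym) (sym ∘ E.to ∘ sym)
      where module E = Equivalence (+ᵥ≡⇔≡-ᵥ α₁ α₂ γ)

    i = 𝟙 (γ ≟ᵥ α₁ +ᵥ α₂)
    q = p^[ 0 - m ]

    p^-factor-square : ∀ n → p^[ n - m ] ≡ p^[ n /2] ⊗ p^[ n /2] ⊗ q
    p^-factor-square n = trans (p^-factor n m) (cong (_⊗ q) (p^½-square n))

  -- Translation between the two types and signed fibre sizes

  module _ {n m} {F : 𝔽ₚ^ n → 𝔽ₚ^ m} where

    hasFibres : ∀ ε α → fromℕ ∣ F ⁻¹ α ∣ ≡ fibreSize n m ε 1√ →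
                (∀ β → β ≢ α → fromℕ ∣ F ⁻¹ β ∣ ≡ fibreSize n m ε 0√) → HasFibres ε F α
    -- Matching on the decision itself makes `𝟙 d` compute to `1√` or `0√`.
    hasFibres ε α at-α off-α .size β = by-cases (β ≟ᵥ α)
      where
      by-cases : (d : Dec (β ≡ α)) → fromℕ ∣ F ⁻¹ β ∣ ≡ fibreSize n m ε (𝟙 d)
      by-cases (yes refl) = at-α
      by-cases (no β≢α)   = off-α β β≢α

    hasFibres-at : ∀ {ε α} → HasFibres ε F α → fromℕ ∣ F ⁻¹ α ∣ ≡ fibreSize n m ε 1√
    hasFibres-at {ε} {α} fibres =
      trans (fibres .size α) (cong (fibreSize n m ε) (𝟙-yes (α ≟ᵥ α) refl))

    hasFibres-off : ∀ {ε α} → HasFibres ε F α →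
                    ∀ β → β ≢ α → fromℕ ∣ F ⁻¹ β ∣ ≡ fibreSize n m ε 0√
    hasFibres-off {ε} {α} fibres β β≢α =
      trans (fibres .size β) (cong (fibreSize n m ε) (𝟙-no (β ≟ᵥ α) β≢α))

    almostBalanced⁺⇒hasFibres : AlmostBalanced⁺ F → ∃[ α ] HasFibres 1√ F α
    almostBalanced⁺⇒hasFibres F⁺ =
      let α , at-α , off-α = AlmostBalanced⁺.fibres F⁺ in
      α , hasFibres 1√ α
        (trans at-α (sym (⁺-at p^[ n - m ] p^[ n /2] p^[ n /2- m ])))
        (λ β β≢α → trans (off-α β β≢α) (sym (⁺-off p^[ n - m ] p^[ n /2] p^[ n /2- m ])))

    almostBalanced⁻⇒hasFibres : AlmostBalanced⁻ F → ∃[ α ] HasFibres (⊝ 1√) F α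
    almostBalanced⁻⇒hasFibres F⁻ =
      let α , at-α , off-α = AlmostBalanced⁻.fibres F⁻ in
      α , hasFibres (⊝ 1√) α
        (trans at-α (sym (⁻-at p^[ n - m ] p^[ n /2] p^[ n /2- m ])))
        (λ β β≢α → trans (off-α β β≢α) (sym (⁻-off p^[ n - m ] p^[ n /2] p^[ n /2- m ])))

    hasFibres⇒almostBalanced⁺ : ∀ {α} → Bent F → HasFibres 1√ F α → AlmostBalanced⁺ F
    hasFibres⇒almostBalanced⁺ {α} bent fibres = record
      { bent   = bent
      ; fibres = α
        , trans (hasFibres-at fibres) (⁺-at p^[ n - m ] p^[ n /2] p^[ n /2- m ])
        , λ β β≢α → trans (hasFibres-off fibres β β≢α)
            (⁺-off p^[ n - m ] p^[ n /2] p^[ n /2- m ])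
      }

    hasFibres⇒almostBalanced⁻ : ∀ {α} → Bent F → HasFibres (⊝ 1√) F α → AlmostBalanced⁻ F
    hasFibres⇒almostBalanced⁻ {α} bent fibres = record
      { bent   = bent
      ; fibres = α
        , trans (hasFibres-at fibres) (⁻-at p^[ n - m ] p^[ n /2] p^[ n /2- m ])
        , λ β β≢α → trans (hasFibres-off fibres β β≢α)
            (⁻-off p^[ n - m ] p^[ n /2] p^[ n /2- m ])
      }

proposition3p10 : ∀ {p : ℕ} (p-prime : Prime p) → let open Bentness p-prime in
    ∀ (n k m : ℕ) (F₁ : 𝔽ₚ^ n → 𝔽ₚ^ m) (F₂ : 𝔽ₚ^ k → 𝔽ₚ^ m) →
    AlmostBalanced F₁ → AlmostBalanced F₂ →
    (AlmostBalanced⁺ F₁ → AlmostBalanced⁺ F₂ → AlmostBalanced⁺ (directSum F₁ F₂ ∘ split n)) ×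
    (AlmostBalanced⁻ F₁ → AlmostBalanced⁻ F₂ → AlmostBalanced⁺ (directSum F₁ F₂ ∘ split n)) ×
    (AlmostBalanced⁺ F₁ → AlmostBalanced⁻ F₂ → AlmostBalanced⁻ (directSum F₁ F₂ ∘ split n))
proposition3p10 p-prime n k m F₁ F₂ _ _ =
    -- The resulting signs in the three cases are `1 · 1`, `(-1) · (-1)` and `1 · (-1)`.
    (λ F₁⁺ F₂⁺ →
      let α₁ , fibres₁ = almostBalanced⁺⇒hasFibres F₁⁺
          α₂ , fibres₂ = almostBalanced⁺⇒hasFibres F₂⁺
      in hasFibres⇒almostBalanced⁺
        (directSum-bent F₁ F₂ (AlmostBalanced⁺.bent F₁⁺) (AlmostBalanced⁺.bent F₂⁺))
        (directSum-hasFibres (*-identityˡ 1√) fibres₁ fibres₂))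
  , (λ F₁⁻ F₂⁻ →
      let α₁ , fibres₁ = almostBalanced⁻⇒hasFibres F₁⁻
          α₂ , fibres₂ = almostBalanced⁻⇒hasFibres F₂⁻
      in hasFibres⇒almostBalanced⁺
        (directSum-bent F₁ F₂ (AlmostBalanced⁻.bent F₁⁻) (AlmostBalanced⁻.bent F₂⁻))
        (directSum-hasFibres -1*-1≡1 fibres₁ fibres₂))
  , (λ F₁⁺ F₂⁻ →
      let α₁ , fibres₁ = almostBalanced⁺⇒hasFibres F₁⁺
          α₂ , fibres₂ = almostBalanced⁻⇒hasFibres F₂⁻
      in hasFibres⇒almostBalanced⁻
        (directSum-bent F₁ F₂ (AlmostBalanced⁺.bent F₁⁺) (AlmostBalanced⁻.bent F₂⁻))
        (directSum-hasFibres (*-identityˡ (⊝ 1√)) fibres₁ fibres₂))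
  where
  open Bentness p-prime
  open DirectSum p-prime
  open CommutativeRing ⊕-⊗-commutativeRing using (*-identityˡ)
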